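{- Let $f:G_1\to G_2$ be a graph homomorphism. Then the map $H(f):H(\mathcal{G}_1)\to H(\mathcal{G}_2)$ is an algebra morphism.
   Context: $\mathbf{k}$ is a unitary commutative ring. Graphs are connected, undirected, without multiple edges and loops, with vertices labelled by natural numbers. For a graph $G_i$, $\mathcal{G}_i$ is the set of nonempty connected subgraphs of $G_i$ (a subgraph is a graph all of whose vertices lie in $V(G_i)$ and all of whose edges lie in $E(G_i)$). $M(\mathcal{G}_i)$ is the free monoid on $\mathcal{G}_i$ under concatenation, with unit the empty graph $\mathbf{1}_{G_i}$, and $H(\mathcal{G}_i)=\mathbf{k}M(\mathcal{G}_i)$ is the free $\mathbf{k}$-module on $M(\mathcal{G}_i)$ with concatenation extended linearly; it is the free $\mathbf{k}$-algebra on $\mathcal{G}_i$. A graph homomorphism $f:G_1\to G_2$ is a map $f:V(G_1)\to V(G_2)$ such that $(f(u),f(v))\in E(G_2)$ whenever $(u,v)\in E(G_1)$. For a subgraph $\Gamma$ of $G_1$, $f(\Gamma)$ denotes its image, the subgraph of $G_2$ with vertex set $f(V(\Gamma))$ and edges $(f(u),f(v))$ for $(u,v)\in E(\Gamma)$. The linear map $H(f)$ is defined by $H(f)(\mathbf{1}_{G_1})=\mathbf{1}_{G_2}$ and $H(f)(\Gamma_1\cdots\Gamma_n)=f(\Gamma_1)\cdots f(\Gamma_n)$ for $\Gamma_1,\dots,\Gamma_n\in\mathcal{G}_1$, $n\ge1$. Algebra morphisms preserve products and units. -}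

module Defs where

open import Level using (Level; _⊔_) renaming (zero to 0ℓ; suc to lsuc)
open import Algebra.Bundles using (CommutativeRing; Ring; Monoid)
open import Algebra.Module.Core using (Opₗ)
open import Algebra.Module.Structures using (IsLeftModule)
open import Algebra.Module.Morphism.Definitions using (Homomorphicₗ)
open import Algebra.Morphism.Structures using (module RingMorphisms)
import Algebra.Properties.Ring as RingProperties
open import Data.List.Base using (List; []; _∷_; _++_; map; concatMap)
import Data.List.Properties as List
import Data.List.Relation.Binary.Equality.Setoid.Properties as ListSetoid
open import Data.Nat.Base using (ℕ)
open import Data.Product.Base using (Σ; ∃; ∃₂; _×_; _,_; proj₁; proj₂)
open import Function.Base using (id; _∘_)
open import Function.Bundles using (Func)
open import Relation.Binary.Bundles using (Setoid)
open import Relation.Binary.Core using (Rel; _⇒_)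
open import Relation.Binary.Definitions using (Symmetric; Irreflexive)
open import Relation.Binary.Structures using (IsEquivalence)
open import Relation.Binary.Construct.Closure.ReflexiveTransitive
  using (Star; ε; _◅_)
import Relation.Binary.Construct.On as On
import Relation.Binary.Reasoning.Setoid as SetoidReasoning
open import Relation.Binary.PropositionalEquality as ≡ using (_≡_)
open import Relation.Unary using (Pred; _∈_; _⊆_)

private
  variable
    c ℓ a ℓa b ℓb m ℓm n ℓn : Level

------------------------------------------------------------------------
-- Graphs

-- Vertices are natural numbers, so that "all vertices of Γ lie in V(G)"
-- makes literal sense.  The empty graph is allowed; nonemptiness is
-- imposed separately where it is needed.
record Graph : Set₁ where
  field
    V         : Pred ℕ 0ℓ
    E         : Rel ℕ 0ℓ
    E⇒V       : ∀ {u v} → E u v → u ∈ V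
    E-sym     : Symmetric E
    E-irrefl  : Irreflexive _≡_ E
    connected : ∀ {u v} → u ∈ V → v ∈ V → Star E u v

  Vertex : Set
  Vertex = ∃ V

  -- Two elements of Vertex are the same vertex when their labels agree,
  -- whatever the membership proofs.
  vertices : Setoid 0ℓ 0ℓ
  vertices = On.setoid (≡.setoid ℕ) (proj₁ {B = V})

record _⊆ᴳ_ (Γ G : Graph) : Set where
  constructor _,_
  field
    V⊆ : Graph.V Γ ⊆ Graph.V G
    E⊆ : Graph.E Γ ⇒ Graph.E G

open _⊆ᴳ_

record _≈ᴳ_ (Γ Δ : Graph) : Set where
  constructor _,_
  field
    ⊆ : Γ ⊆ᴳ Δ
    ⊇ : Δ ⊆ᴳ Γ

≈ᴳ-isEquivalence : IsEquivalence _≈ᴳ_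
≈ᴳ-isEquivalence = record
  { refl  = (id , id) , (id , id)
  ; sym   = λ (p , q) → q , p
  ; trans = λ ((p , p′) , (q , q′)) ((r , r′) , (s , s′)) →
              ((r ∘ p) , (r′ ∘ p′)) , ((q ∘ s) , (q′ ∘ s′))
  }

-- Connectedness is part of Graph.
record ConnectedSubgraph (G : Graph) : Set₁ where
  field
    graph    : Graph
    subgraph : graph ⊆ᴳ G
    nonempty : Graph.Vertex graph

  inclusion : Graph.Vertex graph → Graph.Vertex G
  inclusion (u , u∈Γ) = u , V⊆ subgraph u∈Γ

-- The set 𝒢 of nonempty connected subgraphs of G.
𝒢 : Graph → Setoid (lsuc 0ℓ) 0ℓ
𝒢 G = record
  { Carrier       = ConnectedSubgraph G
  ; _≈_           = λ Γ Δ → ConnectedSubgraph.graph Γ ≈ᴳ ConnectedSubgraph.graph Δ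
  ; isEquivalence = On.isEquivalence ConnectedSubgraph.graph ≈ᴳ-isEquivalence
  }

record GraphHom (G₁ G₂ : Graph) : Set where
  private
    module G₁ = Graph G₁
    module G₂ = Graph G₂
  field
    func     : Func G₁.vertices G₂.vertices
  open Func func public
  field
    preserves : ∀ (x y : G₁.Vertex) → G₁.E (proj₁ x) (proj₁ y) →
                G₂.E (proj₁ (to x)) (proj₁ (to y))

module _ {G₁ G₂ : Graph} (f : GraphHom G₁ G₂) where
  private
    module f = GraphHom f

  module Image (Γ : ConnectedSubgraph G₁) where
    open ConnectedSubgraph Γ
    private
      module Γ  = Graph graph
      module G₂ = Graph G₂

    vertex : Γ.Vertex → ℕ
    vertex x = proj₁ (f.to (inclusion x))

    V : Pred ℕ 0ℓ
    V m = ∃ λ x → vertex x ≡ m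

    E : Rel ℕ 0ℓ
    E m n = ∃₂ λ x y → Γ.E (proj₁ x) (proj₁ y) × vertex x ≡ m × vertex y ≡ n

    E⊆E₂ : E ⇒ G₂.E
    E⊆E₂ (x , y , xy , ≡.refl , ≡.refl) =
      f.preserves (inclusion x) (inclusion y) (E⊆ subgraph xy)

    walk : ∀ {u v} (u∈Γ : u ∈ Γ.V) (v∈Γ : v ∈ Γ.V) → Star Γ.E u v →
           Star E (vertex (u , u∈Γ)) (vertex (v , v∈Γ))
    walk {u} u∈Γ v∈Γ ε =
      ≡.subst (Star E (vertex (u , u∈Γ))) (f.cong ≡.refl) ε
    walk u∈Γ v∈Γ (uw ◅ wv) =
      ((_ , u∈Γ) , (_ , w∈Γ) , uw , ≡.refl , ≡.refl) ◅ walk w∈Γ v∈Γ wv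
      where w∈Γ = Γ.E⇒V (Γ.E-sym uw)

    imageGraph : Graph
    imageGraph = record
      { V         = V
      ; E         = E
      ; E⇒V       = λ (x , _ , _ , p , _) → x , p
      ; E-sym     = λ (x , y , xy , p , q) → y , x , Γ.E-sym xy , q , p
      ; E-irrefl  = λ p e → G₂.E-irrefl p (E⊆E₂ e)
      ; connected = λ { ((_ , u∈Γ) , ≡.refl) ((_ , v∈Γ) , ≡.refl) →
                        walk u∈Γ v∈Γ (Γ.connected u∈Γ v∈Γ) }
      }

    image : ConnectedSubgraph G₂
    image = record
      { graph    = imageGraph
      ; subgraph = (λ { (x , ≡.refl) → proj₂ (f.to (inclusion x)) }) , E⊆E₂
      ; nonempty = vertex nonempty , nonempty , ≡.refl
      }

  open Image public using (image)

------------------------------------------------------------------------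
-- Associative unital algebras

record Algebra (K : CommutativeRing c ℓ) (a ℓa : Level)
               : Set (c ⊔ ℓ ⊔ lsuc (a ⊔ ℓa)) where
  private
    module K = CommutativeRing K
  infixr 7 _*ₗ_
  field
    ring : Ring a ℓa
  open Ring ring public
  field
    _*ₗ_         : Opₗ K.Carrier Carrier
    isLeftModule : IsLeftModule K.ring _≈_ _+_ 0# (-_) _*ₗ_
    *ₗ-*-assoc   : ∀ r x y → r *ₗ (x * y) ≈ (r *ₗ x) * y
    *ₗ-*-comm    : ∀ r x y → r *ₗ (x * y) ≈ x * (r *ₗ y)

module _ {K : CommutativeRing c ℓ} (A : Algebra K a ℓa) (B : Algebra K b ℓb) where
  private
    module K = CommutativeRing K
    module A = Algebra A
    module B = Algebra B

  record IsAlgebraHomomorphism (φ : A.Carrier → B.Carrier)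
                               : Set (c ⊔ a ⊔ ℓa ⊔ ℓb) where
    field
      isRingHomomorphism :
        RingMorphisms.IsRingHomomorphism A.rawRing B.rawRing φ
      *ₗ-homo : Homomorphicₗ K.Carrier A.Carrier B.Carrier B._≈_ φ A._*ₗ_ B._*ₗ_

------------------------------------------------------------------------
-- The monoid algebra 𝐤M

module MonoidAlgebra (K : CommutativeRing c ℓ) (M : Monoid m ℓm) where
  private
    module K = CommutativeRing K
    module M = Monoid M
    open RingProperties K.ring using (-‿distribˡ-*; -0#≈0#)
    open import Algebra.Properties.AbelianGroup K.+-abelianGroup
      using (⁻¹-∙-comm)

  Term : Set (c ⊔ m)
  Term = K.Carrier × M.Carrier

  -- The list of the terms (r , x) stands for the sum of the r·x.
  Combination : Set (c ⊔ m)
  Combination = List Term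

  infix 4 _≋_

  -- Equality in the free module on M.  Comparing coefficients would need
  -- a decidable equality on M, so the relations r·x + s·x = (r+s)·x and
  -- 0·x = 0 are imposed on formal sums instead.
  data _≋_ : Rel Combination (c ⊔ ℓ ⊔ m ⊔ ℓm) where
    refl  : ∀ {xs} → xs ≋ xs
    sym   : ∀ {xs ys} → xs ≋ ys → ys ≋ xs
    trans : ∀ {xs ys zs} → xs ≋ ys → ys ≋ zs → xs ≋ zs
    cons  : ∀ {r s x y xs ys} → r K.≈ s → x M.≈ y → xs ≋ ys →
            (r , x) ∷ xs ≋ (s , y) ∷ ys
    swap  : ∀ {p q xs} → p ∷ q ∷ xs ≋ q ∷ p ∷ xs
    merge : ∀ {r s x xs} → (r , x) ∷ (s , x) ∷ xs ≋ (r K.+ s , x) ∷ xs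
    drop  : ∀ {x xs} → (K.0# , x) ∷ xs ≋ xs

  _·ₜ_ : K.Carrier → Term → Term
  r ·ₜ (s , x) = r K.* s , x

  -ₜ_ : Term → Term
  -ₜ (r , x) = K.- r , x

  _*ₜ_ : Term → Term → Term
  (r , x) *ₜ (s , y) = r K.* s , x M.∙ y

  _·_ : K.Carrier → Combination → Combination
  r · xs = map (r ·ₜ_) xs

  -_ : Combination → Combination
  - xs = map -ₜ_ xs

  _*_ : Combination → Combination → Combination
  xs * ys = concatMap (λ p → map (p *ₜ_) ys) xs

  1# : Combination
  1# = (K.1# , M.ε) ∷ []

  infixr 8 -_
  infixr 7 _·_
  infixl 7 _*_

  isEquivalence : IsEquivalence _≋_
  isEquivalence = record { refl = refl ; sym = sym ; trans = trans }

  setoid : Setoid (c ⊔ m) (c ⊔ ℓ ⊔ m ⊔ ℓm)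
  setoid = record { isEquivalence = isEquivalence }

  open SetoidReasoning setoid

  ≡⇒≋ : ∀ {xs ys} → xs ≡ ys → xs ≋ ys
  ≡⇒≋ ≡.refl = refl

  prep : ∀ p {xs ys} → xs ≋ ys → p ∷ xs ≋ p ∷ ys
  prep _ = cons K.refl M.refl

  ++-congʳ : ∀ {xs ys} zs → xs ≋ ys → xs ++ zs ≋ ys ++ zs
  ++-congʳ zs refl         = refl
  ++-congʳ zs (sym e)      = sym (++-congʳ zs e)
  ++-congʳ zs (trans e e′) = trans (++-congʳ zs e) (++-congʳ zs e′)
  ++-congʳ zs (cons p q e) = cons p q (++-congʳ zs e)
  ++-congʳ zs swap         = swap
  ++-congʳ zs merge        = merge
  ++-congʳ zs drop         = drop

  ++-congˡ : ∀ xs {ys zs} → ys ≋ zs → xs ++ ys ≋ xs ++ zs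
  ++-congˡ []       e = e
  ++-congˡ (p ∷ xs) e = prep p (++-congˡ xs e)

  ++-cong : ∀ {xs ys zs ws} → xs ≋ ys → zs ≋ ws → xs ++ zs ≋ ys ++ ws
  ++-cong {ys = ys} {zs = zs} e e′ = trans (++-congʳ zs e) (++-congˡ ys e′)

  ++-assoc : ∀ xs ys zs → (xs ++ ys) ++ zs ≋ xs ++ (ys ++ zs)
  ++-assoc xs ys zs = ≡⇒≋ (List.++-assoc xs ys zs)

  shift : ∀ p xs ys → xs ++ p ∷ ys ≋ p ∷ xs ++ ys
  shift p []       ys = refl
  shift p (q ∷ xs) ys = trans (prep q (shift p xs ys)) swap

  ++-comm : ∀ xs ys → xs ++ ys ≋ ys ++ xs
  ++-comm []       ys = ≡⇒≋ (≡.sym (List.++-identityʳ ys))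
  ++-comm (p ∷ xs) ys = trans (prep p (++-comm xs ys)) (sym (shift p ys xs))

  interchange : ∀ ws xs ys zs → (ws ++ xs) ++ (ys ++ zs) ≋ (ws ++ ys) ++ (xs ++ zs)
  interchange ws xs ys zs = begin
    (ws ++ xs) ++ (ys ++ zs)  ≈⟨ ++-assoc ws xs (ys ++ zs) ⟩
    ws ++ (xs ++ (ys ++ zs))  ≈⟨ ++-congˡ ws (++-assoc xs ys zs) ⟨
    ws ++ ((xs ++ ys) ++ zs)  ≈⟨ ++-congˡ ws (++-congʳ zs (++-comm xs ys)) ⟩
    ws ++ ((ys ++ xs) ++ zs)  ≈⟨ ++-congˡ ws (++-assoc ys xs zs) ⟩
    ws ++ (ys ++ (xs ++ zs))  ≈⟨ ++-assoc ws ys (xs ++ zs) ⟨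
    (ws ++ ys) ++ (xs ++ zs)  ∎

  ·-cong : ∀ {r s xs ys} → r K.≈ s → xs ≋ ys → r · xs ≋ s · ys
  ·-cong {r} {s} {xs} r≈s e = trans (change xs) (congruence e)
    where
    change : ∀ xs → r · xs ≋ s · xs
    change []       = refl
    change (p ∷ xs) = cons (K.*-congʳ r≈s) M.refl (change xs)
    congruence : ∀ {xs ys} → xs ≋ ys → s · xs ≋ s · ys
    congruence refl         = refl
    congruence (sym e)      = sym (congruence e)
    congruence (trans e e′) = trans (congruence e) (congruence e′)
    congruence (cons p q e) = cons (K.*-congˡ p) q (congruence e)
    congruence swap         = swap
    congruence merge        = trans merge (cons (K.sym (K.distribˡ s _ _)) M.refl refl)
    congruence drop         = trans (cons (K.zeroʳ s) M.refl refl) drop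

  ·-zeroˡ : ∀ xs → K.0# · xs ≋ []
  ·-zeroˡ []       = refl
  ·-zeroˡ (p ∷ xs) = trans (cons (K.zeroˡ _) M.refl (·-zeroˡ xs)) drop

  ·-distribʳ : ∀ xs r s → (r K.+ s) · xs ≋ r · xs ++ s · xs
  ·-distribʳ []             r s = refl
  ·-distribʳ ((t , x) ∷ xs) r s = begin
    ((r K.+ s) K.* t , x) ∷ (r K.+ s) · xs
      ≈⟨ cons (K.distribʳ t r s) M.refl (·-distribʳ xs r s) ⟩
    (r K.* t K.+ s K.* t , x) ∷ r · xs ++ s · xs
      ≈⟨ merge ⟨
    (r K.* t , x) ∷ (s K.* t , x) ∷ r · xs ++ s · xs
      ≈⟨ prep _ (shift _ (r · xs) (s · xs)) ⟨
    (r K.* t , x) ∷ r · xs ++ (s K.* t , x) ∷ s · xs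
      ∎

  ·-identityˡ : ∀ xs → K.1# · xs ≋ xs
  ·-identityˡ []       = refl
  ·-identityˡ (p ∷ xs) = cons (K.*-identityˡ _) M.refl (·-identityˡ xs)

  ·-assoc : ∀ r s xs → (r K.* s) · xs ≋ r · (s · xs)
  ·-assoc r s []       = refl
  ·-assoc r s (p ∷ xs) = cons (K.*-assoc r s _) M.refl (·-assoc r s xs)

  -‿cong : ∀ {xs ys} → xs ≋ ys → - xs ≋ - ys
  -‿cong refl         = refl
  -‿cong (sym e)      = sym (-‿cong e)
  -‿cong (trans e e′) = trans (-‿cong e) (-‿cong e′)
  -‿cong (cons p q e) = cons (K.-‿cong p) q (-‿cong e)
  -‿cong swap         = swap
  -‿cong merge        = trans merge (cons (⁻¹-∙-comm _ _) M.refl refl)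
  -‿cong drop         = trans (cons -0#≈0# M.refl refl) drop

  -‿inverseʳ : ∀ xs → xs ++ - xs ≋ []
  -‿inverseʳ []             = refl
  -‿inverseʳ ((r , x) ∷ xs) = begin
    (r , x) ∷ xs ++ (K.- r , x) ∷ - xs    ≈⟨ prep _ (shift _ xs (- xs)) ⟩
    (r , x) ∷ (K.- r , x) ∷ xs ++ - xs    ≈⟨ merge ⟩
    (r K.+ K.- r , x) ∷ xs ++ - xs        ≈⟨ cons (K.-‿inverseʳ r) M.refl (-‿inverseʳ xs) ⟩
    (K.0# , x) ∷ []                       ≈⟨ drop ⟩
    []                                    ∎

  -‿inverseˡ : ∀ xs → - xs ++ xs ≋ []
  -‿inverseˡ xs = trans (++-comm (- xs) xs) (-‿inverseʳ xs)

  infixr 7 _▹_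

  _▹_ : Term → Combination → Combination
  p ▹ xs = map (p *ₜ_) xs

  ▹-congˡ : ∀ p {xs ys} → xs ≋ ys → p ▹ xs ≋ p ▹ ys
  ▹-congˡ p refl           = refl
  ▹-congˡ p (sym e)        = sym (▹-congˡ p e)
  ▹-congˡ p (trans e e′)   = trans (▹-congˡ p e) (▹-congˡ p e′)
  ▹-congˡ p (cons e e′ e″) = cons (K.*-congˡ e) (M.∙-congˡ e′) (▹-congˡ p e″)
  ▹-congˡ p swap           = swap
  ▹-congˡ p merge          = trans merge (cons (K.sym (K.distribˡ _ _ _)) M.refl refl)
  ▹-congˡ p drop           = trans (cons (K.zeroʳ _) M.refl refl) drop

  ▹-congʳ : ∀ {r s x y} zs → r K.≈ s → x M.≈ y → (r , x) ▹ zs ≋ (s , y) ▹ zs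
  ▹-congʳ []       e e′ = refl
  ▹-congʳ (q ∷ zs) e e′ = cons (K.*-congʳ e) (M.∙-congʳ e′) (▹-congʳ zs e e′)

  ▹-merge : ∀ r s x zs → (r , x) ▹ zs ++ (s , x) ▹ zs ≋ (r K.+ s , x) ▹ zs
  ▹-merge r s x []             = refl
  ▹-merge r s x ((t , z) ∷ zs) = begin
    (r K.* t , x M.∙ z) ∷ (r , x) ▹ zs ++ (s K.* t , x M.∙ z) ∷ (s , x) ▹ zs
      ≈⟨ prep _ (shift _ ((r , x) ▹ zs) ((s , x) ▹ zs)) ⟩
    (r K.* t , x M.∙ z) ∷ (s K.* t , x M.∙ z) ∷ (r , x) ▹ zs ++ (s , x) ▹ zs
      ≈⟨ merge ⟩
    (r K.* t K.+ s K.* t , x M.∙ z) ∷ (r , x) ▹ zs ++ (s , x) ▹ zs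
      ≈⟨ cons (K.sym (K.distribʳ t r s)) M.refl (▹-merge r s x zs) ⟩
    ((r K.+ s) K.* t , x M.∙ z) ∷ (r K.+ s , x) ▹ zs
      ∎

  ▹-drop : ∀ x zs → (K.0# , x) ▹ zs ≋ []
  ▹-drop x []       = refl
  ▹-drop x (q ∷ zs) = trans (cons (K.zeroˡ _) M.refl (▹-drop x zs)) drop

  ▹-++ : ∀ p xs ys → p ▹ (xs ++ ys) ≋ p ▹ xs ++ p ▹ ys
  ▹-++ p xs ys = ≡⇒≋ (List.map-++ (p *ₜ_) xs ys)

  ▹-▹ : ∀ p q xs → (p *ₜ q) ▹ xs ≋ p ▹ (q ▹ xs)
  ▹-▹ p q []       = refl
  ▹-▹ p q (_ ∷ xs) = cons (K.*-assoc _ _ _) (M.assoc _ _ _) (▹-▹ p q xs)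

  *-congˡ : ∀ xs {ys zs} → ys ≋ zs → xs * ys ≋ xs * zs
  *-congˡ []       e = refl
  *-congˡ (p ∷ xs) e = ++-cong (▹-congˡ p e) (*-congˡ xs e)

  *-congʳ : ∀ {xs ys} zs → xs ≋ ys → xs * zs ≋ ys * zs
  *-congʳ zs refl           = refl
  *-congʳ zs (sym e)        = sym (*-congʳ zs e)
  *-congʳ zs (trans e e′)   = trans (*-congʳ zs e) (*-congʳ zs e′)
  *-congʳ zs (cons e e′ e″) = ++-cong (▹-congʳ zs e e′) (*-congʳ zs e″)
  *-congʳ zs (swap {p} {q} {xs}) = begin
    p ▹ zs ++ (q ▹ zs ++ xs * zs)  ≈⟨ ++-assoc (p ▹ zs) (q ▹ zs) _ ⟨
    (p ▹ zs ++ q ▹ zs) ++ xs * zs  ≈⟨ ++-congʳ _ (++-comm (p ▹ zs) (q ▹ zs)) ⟩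
    (q ▹ zs ++ p ▹ zs) ++ xs * zs  ≈⟨ ++-assoc (q ▹ zs) (p ▹ zs) _ ⟩
    q ▹ zs ++ (p ▹ zs ++ xs * zs)  ∎
  *-congʳ zs (merge {r} {s} {x}) =
    trans (sym (++-assoc ((r , x) ▹ zs) _ _)) (++-congʳ _ (▹-merge r s x zs))
  *-congʳ zs (drop {x})     = ++-congʳ _ (▹-drop x zs)

  *-distribʳ : ∀ xs ys zs → (ys ++ zs) * xs ≋ ys * xs ++ zs * xs
  *-distribʳ xs ys zs = ≡⇒≋ (List.concatMap-++ (_▹ xs) ys zs)

  *-distribˡ : ∀ xs ys zs → xs * (ys ++ zs) ≋ xs * ys ++ xs * zs
  *-distribˡ []       ys zs = refl
  *-distribˡ (p ∷ xs) ys zs = begin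
    p ▹ (ys ++ zs) ++ xs * (ys ++ zs)
      ≈⟨ ++-cong (▹-++ p ys zs) (*-distribˡ xs ys zs) ⟩
    (p ▹ ys ++ p ▹ zs) ++ (xs * ys ++ xs * zs)
      ≈⟨ interchange (p ▹ ys) (p ▹ zs) (xs * ys) (xs * zs) ⟩
    (p ▹ ys ++ xs * ys) ++ (p ▹ zs ++ xs * zs)
      ∎

  ▹-* : ∀ p xs ys → (p ▹ xs) * ys ≋ p ▹ (xs * ys)
  ▹-* p []       ys = refl
  ▹-* p (q ∷ xs) ys = begin
    (p *ₜ q) ▹ ys ++ (p ▹ xs) * ys  ≈⟨ ++-cong (▹-▹ p q ys) (▹-* p xs ys) ⟩
    p ▹ (q ▹ ys) ++ p ▹ (xs * ys)   ≈⟨ ▹-++ p (q ▹ ys) (xs * ys) ⟨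
    p ▹ (q ▹ ys ++ xs * ys)         ∎

  *-assoc : ∀ xs ys zs → (xs * ys) * zs ≋ xs * (ys * zs)
  *-assoc []       ys zs = refl
  *-assoc (p ∷ xs) ys zs = begin
    (p ▹ ys ++ xs * ys) * zs          ≈⟨ *-distribʳ zs (p ▹ ys) (xs * ys) ⟩
    (p ▹ ys) * zs ++ (xs * ys) * zs   ≈⟨ ++-cong (▹-* p ys zs) (*-assoc xs ys zs) ⟩
    p ▹ (ys * zs) ++ xs * (ys * zs)   ∎

  *-identityˡ : ∀ xs → 1# * xs ≋ xs
  *-identityˡ xs = trans (≡⇒≋ (List.++-identityʳ _)) (unit xs)
    where
    unit : ∀ xs → (K.1# , M.ε) ▹ xs ≋ xs
    unit []       = refl
    unit (p ∷ xs) = cons (K.*-identityˡ _) (M.identityˡ _) (unit xs)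

  *-identityʳ : ∀ xs → xs * 1# ≋ xs
  *-identityʳ []       = refl
  *-identityʳ (p ∷ xs) = cons (K.*-identityʳ _) (M.identityʳ _) (*-identityʳ xs)

  ·-▹ : ∀ r p xs → r · (p ▹ xs) ≋ (r ·ₜ p) ▹ xs
  ·-▹ r p []       = refl
  ·-▹ r p (q ∷ xs) = cons (K.sym (K.*-assoc _ _ _)) M.refl (·-▹ r p xs)

  ▹-· : ∀ r p xs → r · (p ▹ xs) ≋ p ▹ (r · xs)
  ▹-· r p []       = refl
  ▹-· r (s , x) ((t , y) ∷ xs) = cons commute M.refl (▹-· r (s , x) xs)
    where
    commute : r K.* (s K.* t) K.≈ s K.* (r K.* t)
    commute = K.trans (K.sym (K.*-assoc r s t))
      (K.trans (K.*-congʳ (K.*-comm r s)) (K.*-assoc s r t))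

  ·-++ : ∀ r xs ys → r · (xs ++ ys) ≋ r · xs ++ r · ys
  ·-++ r xs ys = ≡⇒≋ (List.map-++ (r ·ₜ_) xs ys)

  ·-*-assoc : ∀ r xs ys → r · (xs * ys) ≋ (r · xs) * ys
  ·-*-assoc r []       ys = refl
  ·-*-assoc r (p ∷ xs) ys =
    trans (·-++ r (p ▹ ys) (xs * ys)) (++-cong (·-▹ r p ys) (·-*-assoc r xs ys))

  ·-*-comm : ∀ r xs ys → r · (xs * ys) ≋ xs * (r · ys)
  ·-*-comm r []       ys = refl
  ·-*-comm r (p ∷ xs) ys =
    trans (·-++ r (p ▹ ys) (xs * ys)) (++-cong (▹-· r p ys) (·-*-comm r xs ys))

  ring : Ring (c ⊔ m) (c ⊔ ℓ ⊔ m ⊔ ℓm)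
  ring = record
    { Carrier = Combination
    ; _≈_     = _≋_
    ; _+_     = _++_
    ; _*_     = _*_
    ; -_      = -_
    ; 0#      = []
    ; 1#      = 1#
    ; isRing  = record
      { +-isAbelianGroup = record
        { isGroup = record
          { isMonoid = record
            { isSemigroup = record
              { isMagma = record { isEquivalence = isEquivalence ; ∙-cong = ++-cong }
              ; assoc   = ++-assoc
              }
            ; identity = (λ _ → refl) , λ xs → ≡⇒≋ (List.++-identityʳ xs)
            }
          ; inverse = -‿inverseˡ , -‿inverseʳ
          ; ⁻¹-cong = -‿cong
          }
        ; comm = ++-comm
        }
      ; *-cong     = λ {xs} {ys} {zs} {ws} e e′ → trans (*-congʳ zs e) (*-congˡ ys e′)
      ; *-assoc    = *-assoc
      ; *-identity = *-identityˡ , *-identityʳ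
      ; distrib    = *-distribˡ , *-distribʳ
      }
    }

  algebra : Algebra K (c ⊔ m) (c ⊔ ℓ ⊔ m ⊔ ℓm)
  algebra = record
    { ring         = ring
    ; _*ₗ_         = _·_
    ; isLeftModule = record
      { isLeftSemimodule = record
        { +ᴹ-isCommutativeMonoid = Ring.+-isCommutativeMonoid ring
        ; isPreleftSemimodule    = record
          { *ₗ-cong      = ·-cong
          ; *ₗ-zeroˡ     = ·-zeroˡ
          ; *ₗ-distribʳ  = ·-distribʳ
          ; *ₗ-identityˡ = ·-identityˡ
          ; *ₗ-assoc     = ·-assoc
          ; *ₗ-zeroʳ     = λ _ → refl
          ; *ₗ-distribˡ  = ·-++
          }
        }
      ; -ᴹ‿cong    = -‿cong
      ; -ᴹ‿inverse = -‿inverseˡ , -‿inverseʳ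
      }
    ; *ₗ-*-assoc = ·-*-assoc
    ; *ₗ-*-comm  = ·-*-comm
    }

------------------------------------------------------------------------
-- H(𝒢) and H(f)

-- Words of nonempty connected subgraphs under concatenation; the empty
-- word is the empty graph 𝟏.
FreeMonoid : Graph → Monoid (lsuc 0ℓ) (lsuc 0ℓ)
FreeMonoid G = ListSetoid.monoid (𝒢 G)

module _ (K : CommutativeRing c ℓ) where
  private
    module K = CommutativeRing K

  H : Graph → Algebra K (c ⊔ lsuc 0ℓ) (c ⊔ ℓ ⊔ lsuc 0ℓ)
  H G = MonoidAlgebra.algebra K (FreeMonoid G)

  H[_] : ∀ {G₁ G₂} → GraphHom G₁ G₂ →
         Algebra.Carrier (H G₁) → Algebra.Carrier (H G₂)
  H[ f ] = map λ (r , Γs) → r , map (image f) Γs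

{-# OPTIONS --safe #-}
module Submission where

open import Level using (Level)
open import Algebra.Bundles using (CommutativeRing; Monoid)
open import Algebra.Morphism.Structures using (module MonoidMorphisms)
open import Data.List.Base using ([]; _∷_; _++_; map)
import Data.List.Properties as List
import Data.List.Relation.Binary.Pointwise as Pointwise
open import Data.Product.Base using (_,_; map₂)
open import Relation.Binary.PropositionalEquality as ≡ using ()
open import Defs

-- k[-] is functorial, so it is enough that f acts on words by a morphism of
-- monoids.  Being a map of words letter by letter, this only requires that
-- equal subgraphs have equal images.

-- The product of a monoid algebra is bilinear and restricts to the monoid law on basis elements, so
-- the linear extension of a monoid morphism is multiplicative (`mapTerms-*`). It respects equality
-- of formal sums (`mapTerms-cong`) because it leaves coefficients alone. Taking images letter by
-- letter preserves concatenation and the empty word, and `image-cong` makes it respect equality of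
-- words.

module _ {c ℓ m ℓm n ℓn : Level} (K : CommutativeRing c ℓ)
         {M : Monoid m ℓm} {N : Monoid n ℓn} where
  private
    module K  = CommutativeRing K
    module M  = Monoid M
    module N  = Monoid N
    module KM = MonoidAlgebra K M
    module KN = MonoidAlgebra K N
  open MonoidMorphisms M.rawMonoid N.rawMonoid

  module _ {φ : M.Carrier → N.Carrier} (φ-homo : IsMonoidHomomorphism φ) where
    private
      module φ = IsMonoidHomomorphism φ-homo

    mapTerms : KM.Combination → KN.Combination
    mapTerms = map (map₂ φ)

    -- Equality of formal sums is generated by relations, and each is sent to an instance of the
    -- same relation; only `cons` calls on `φ` respecting equality.
    mapTerms-cong : ∀ {xs ys} → xs KM.≋ ys → mapTerms xs KN.≋ mapTerms ys
    mapTerms-cong KM.refl         = KN.refl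
    mapTerms-cong (KM.sym e)      = KN.sym (mapTerms-cong e)
    mapTerms-cong (KM.trans e e′) = KN.trans (mapTerms-cong e) (mapTerms-cong e′)
    mapTerms-cong (KM.cons p q e) = KN.cons p (φ.⟦⟧-cong q) (mapTerms-cong e)
    mapTerms-cong KM.swap         = KN.swap
    mapTerms-cong KM.merge        = KN.merge
    mapTerms-cong KM.drop         = KN.drop

    mapTerms-++ : ∀ xs ys → mapTerms (xs ++ ys) KN.≋ mapTerms xs ++ mapTerms ys
    mapTerms-++ xs ys = KN.≡⇒≋ (List.map-++ (map₂ φ) xs ys)

    mapTerms-‿- : ∀ xs → mapTerms (KM.- xs) KN.≋ KN.- mapTerms xs
    -- Both sides fuse into one `map` over `xs`, with the same function by computation: negation
    -- touches only coefficients, `φ` only monoid elements.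
    mapTerms-‿- xs = KN.≡⇒≋ (≡.trans (≡.sym (List.map-∘ xs)) (List.map-∘ xs))

    mapTerms-· : ∀ r xs → mapTerms (r KM.· xs) KN.≋ r KN.· mapTerms xs
    mapTerms-· r xs = KN.≡⇒≋ (≡.trans (≡.sym (List.map-∘ xs)) (List.map-∘ xs))

    -- Multiplicativity of `φ` enters here, term by term; the coefficient products already coincide.
    mapTerms-▹ : ∀ p xs → mapTerms (p KM.▹ xs) KN.≋ map₂ φ p KN.▹ mapTerms xs
    mapTerms-▹ p []       = KN.refl
    mapTerms-▹ p (q ∷ xs) = KN.cons K.refl (φ.homo _ _) (mapTerms-▹ p xs)

    mapTerms-* : ∀ xs ys → mapTerms (xs KM.* ys) KN.≋ mapTerms xs KN.* mapTerms ys
    mapTerms-* []       ys = KN.refl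
    mapTerms-* (p ∷ xs) ys = KN.trans (mapTerms-++ (p KM.▹ ys) (xs KM.* ys))
      (KN.++-cong (mapTerms-▹ p ys) (mapTerms-* xs ys))

    mapTerms-isAlgebraHomomorphism :
      IsAlgebraHomomorphism KM.algebra KN.algebra mapTerms
    mapTerms-isAlgebraHomomorphism = record
      { isRingHomomorphism = record
        { isSemiringHomomorphism = record
          { isNearSemiringHomomorphism = record
            { +-isMonoidHomomorphism = record
              { isMagmaHomomorphism = record
                { isRelHomomorphism = record { cong = mapTerms-cong }
                ; homo                = mapTerms-++
                }
              ; ε-homo = KN.refl
              }
            ; *-homo = mapTerms-*
            }
          ; 1#-homo = KN.cons K.refl φ.ε-homo KN.refl
          }
        ; -‿homo = mapTerms-‿-
        }
      ; *ₗ-homo = mapTerms-·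
      }

module _ {G₁ G₂ : Graph} (f : GraphHom G₁ G₂) where
  private
    module f = GraphHom f
  open ConnectedSubgraph using (graph)
  open MonoidMorphisms (Monoid.rawMonoid (FreeMonoid G₁))
                       (Monoid.rawMonoid (FreeMonoid G₂))

  -- The two inclusions into G₁ carry different membership proofs, which f
  -- ignores.
  image-mono : ∀ {Γ Δ} → graph Γ ⊆ᴳ graph Δ →
               graph (image f Γ) ⊆ᴳ graph (image f Δ)
  image-mono (V⊆ , E⊆) =
    (λ { ((u , u∈Γ) , p) → (u , V⊆ u∈Γ) , ≡.trans (f.cong ≡.refl) p }) ,
    (λ { ((u , u∈Γ) , (v , v∈Γ) , uv , p , q) →
         (u , V⊆ u∈Γ) , (v , V⊆ v∈Γ) , E⊆ uv ,
         ≡.trans (f.cong ≡.refl) p , ≡.trans (f.cong ≡.refl) q })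

  image-cong : ∀ {Γ Δ} → graph Γ ≈ᴳ graph Δ →
               graph (image f Γ) ≈ᴳ graph (image f Δ)
  image-cong {Γ} {Δ} (Γ⊆Δ , Δ⊆Γ) =
    image-mono {Γ} {Δ} Γ⊆Δ , image-mono {Δ} {Γ} Δ⊆Γ

  map-image-isMonoidHomomorphism : IsMonoidHomomorphism (map (image f))
  map-image-isMonoidHomomorphism = record
    { isMagmaHomomorphism = record
      { isRelHomomorphism = record
        { cong = λ e → Pointwise.map⁺ (image f) (image f)
                         -- `Γ` and `Δ` are passed by hand, since they cannot be recovered from
                         -- `graph Γ` and `graph Δ`.
                         (Pointwise.map (λ {Γ} {Δ} → image-cong {Γ} {Δ}) e)
        }
      ; homo = λ Γs Δs →
          Monoid.reflexive (FreeMonoid G₂) (List.map-++ (image f) Γs Δs)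
      }
    ; ε-homo = Monoid.refl (FreeMonoid G₂)
    }

theorem3p12 : ∀ {c ℓ : Level} (𝐤 : CommutativeRing c ℓ) {G₁ G₂ : Graph}
    (f : GraphHom G₁ G₂) →
    IsAlgebraHomomorphism (H 𝐤 G₁) (H 𝐤 G₂) (H[_] 𝐤 f)
theorem3p12 𝐤 f =
  -- `H[ f ]` agrees by computation with `mapTerms` for the word map `map (image f)`.
  mapTerms-isAlgebraHomomorphism 𝐤 (map-image-isMonoidHomomorphism f)
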